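{- Let $n\ge 8$ be even. Let $v=(0,1,2,\dots,2,1)'\in\mathbb{R}^{n-1}$, $\widetilde{D}={\rm Circ}(v')$, and \[B := {\rm Circ}\Big(\frac{n-1}{2}v'-\frac{3}{2}\mathbf{1}'+\sum_{k=1}^{\frac{n}{2}-1}(-1)^{k}\frac{(n-1)-2k}{2}{c^k}'\widetilde{D}\Big).\] Then $B=-2I- \frac{1}{2} J$.
   Context: $\mathbf{1}$ is the all-ones vector in $\mathbb{R}^{n-1}$, $I$ and $J$ the $(n-1)\times(n-1)$ identity and all-ones matrices. The vector $v$ has first entry $0$, second and last entries $1$, and all other entries $2$ (so $\widetilde D$ is the distance matrix of the outer cycle within the wheel graph). For $s=(s_1,\dots,s_\mu)'$, ${\rm Circ}(s')$ is the $\mu\times\mu$ circulant matrix whose first row is $s'$ and each subsequent row is the cyclic right shift of the previous one. For $k\in\{1,\dots,\frac n2-1\}$, $c^k\in\mathbb{R}^{n-1}$ has $c^k_j=1$ if $j=k+1$ or $j=n-k$, and $c^k_j=0$ otherwise. -}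

module Defs where

open import Data.Nat as ℕ using (ℕ; zero; suc; _∸_; _≟_)
open import Data.Nat.DivMod using (_mod_)
open import Data.Fin using (Fin; toℕ)
open import Data.Integer using (+_)
open import Data.Rational using (ℚ; 0ℚ; 1ℚ; _+_; _*_; _-_; -_; _/_)
open import Data.Bool using (if_then_else_; _∨_)
open import Relation.Nullary.Decidable using (does)

-- Vectors in Q^μ and μ×μ matrices, indices 0-based (entry j here = entry j+1 in the paper).
Vecℚ : ℕ → Set
Vecℚ μ = Fin μ → ℚ

Mat : ℕ → Set
Mat μ = Fin μ → Fin μ → ℚ

ΣFin : (μ : ℕ) → (Fin μ → ℚ) → ℚ
ΣFin zero f = 0ℚ
ΣFin (suc μ) f = f Fin.zero + ΣFin μ (λ i → f (Fin.suc i))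

Σℕ : ℕ → (ℕ → ℚ) → ℚ
Σℕ zero f = 0ℚ
Σℕ (suc N) f = Σℕ N f + f N

-- Circ(s'): first row s', each subsequent row the cyclic right shift:
-- Circ(s')_{i,j} = s_{(j - i) mod μ}
Circ : {μ : ℕ} → Vecℚ μ → Mat μ
Circ {zero} s ()
Circ {suc p} s i j = s ((toℕ j ℕ.+ (suc p ∸ toℕ i)) mod suc p)

ℚ-of : ℕ → ℚ
ℚ-of k = + k / 1

vvec : (n : ℕ) → Vecℚ (n ∸ 1)
vvec n j = if does (toℕ j ≟ 0) then 0ℚ
           else if does (toℕ j ≟ 1) ∨ does (toℕ j ≟ n ∸ 2) then 1ℚ
           else ℚ-of 2

Dtilde : (n : ℕ) → Mat (n ∸ 1)
Dtilde n = Circ (vvec n)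

-- c^k: 1 at paper positions k+1 and n-k (0-based: k and n-1-k), 0 elsewhere
cvec : (n k : ℕ) → Vecℚ (n ∸ 1)
cvec n k j = if does (toℕ j ≟ k) ∨ does (toℕ j ≟ n ∸ 1 ∸ k) then 1ℚ else 0ℚ

rowTimes : {μ : ℕ} → Vecℚ μ → Mat μ → Vecℚ μ
rowTimes {μ} x M j = ΣFin μ (λ l → x l * M l j)

one : {μ : ℕ} → Vecℚ μ
one _ = 1ℚ

sgn : ℕ → ℚ
sgn zero = 1ℚ
sgn (suc k) = - sgn k

brow : (n : ℕ) → Vecℚ (n ∸ 1)
brow n j =
  ((ℚ-of (n ∸ 1) * (+ 1 / 2)) * vvec n j - (+ 3 / 2) * one j)
  + Σℕ (n ℕ./ 2 ∸ 1) (λ t → let k = suc t in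
      (sgn k * ((ℚ-of (n ∸ 1) - ℚ-of (2 ℕ.* k)) * (+ 1 / 2)))
        * rowTimes (cvec n k) (Dtilde n) j)

B : (n : ℕ) → Mat (n ∸ 1)
B n = Circ (brow n)

Id : {μ : ℕ} → Mat μ
Id i j = if does (toℕ i ≟ toℕ j) then 1ℚ else 0ℚ

Jm : {μ : ℕ} → Mat μ
Jm _ _ = 1ℚ

-- Write μ = n − 1 = 2m + 1 and extend the coefficients to all 0 ≤ k < μ by
-- sₖ = (−1)ᵏ (μ − 2k)/2. Then s₀ = μ/2 and s_{μ−k} = sₖ, so the first row of B is the
-- cyclic convolution −3/2 + Σₖ sₖ v_{j−k} (indices mod μ). Since v = 2·1 − 2e₀ − e₁ − e_{μ−1},
-- that convolution is 2 Σₖ sₖ − (s_{j−1} + 2 sⱼ + s_{j+1}), and the telescoping identity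
-- sₖ + s_{k+1} = (−1)ᵏ gives Σₖ sₖ = 1/2 and s_{j−1} + 2 sⱼ + s_{j+1} = 2 [j = 0].
-- So the first row of the circulant B is −1/2 − 2 [j = 0].
module Submission where

open import Defs
open import Data.Nat using (ℕ; zero; suc; _∸_; _≤_; _<_; z≤n; s≤s; z<s; _≟_)
import Data.Nat as ℕ
import Data.Nat.Properties as ℕₚ
open import Data.Nat.DivMod using (_%_; _mod_; m%n<n; m<n⇒m%n≡m; [m+n]%n≡m%n; m*n/n≡m)
open import Data.Nat.Divisibility using (_∣_; divides)
open import Data.Fin using (Fin; toℕ)
open import Data.Fin.Properties using (toℕ<n; toℕ-fromℕ<)
import Data.Integer as ℤ
open import Data.Integer using (+_)
import Data.Integer.Properties as ℤₚ
open import Data.Integer.Tactic.RingSolver using (solve-∀)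
open import Data.Rational using (ℚ; 0ℚ; 1ℚ; _+_; _*_; _-_; -_; _/_; toℚᵘ)
open import Data.Rational.Properties
  using ( toℚᵘ-injective; toℚᵘ-fromℚᵘ; toℚᵘ-homo-+; toℚᵘ-homo-*
        ; +-assoc; +-comm; +-identityˡ; +-identityʳ; +-inverseˡ; +-inverseʳ
        ; +-0-group; *-identityˡ; *-zeroˡ; *-zeroʳ; *-distribˡ-+; *-distribʳ-+ )
open import Algebra.Properties.Group +-0-group using () renaming (⁻¹-involutive to neg-involutive)
import Data.Rational.Unnormalised as ℚᵘ
import Data.Rational.Unnormalised.Properties as ℚᵘ
open import Data.Rational.Solver using (module +-*-Solver)
open +-*-Solver using (solve; _:=_; _:+_; _:*_; _:-_; :-_; con)
open import Data.Bool using (if_then_else_; _∨_; true; false)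
open import Data.Sum using (inj₁; inj₂)
open import Function using (_∘_)
open import Relation.Nullary using (contradiction)
open import Relation.Nullary.Decidable using (does; yes; no; dec-true; dec-false)
open import Relation.Binary.PropositionalEquality

½ : ℚ
½ = + 1 / 2

cong₃ : ∀ {A B C D : Set} (f : A → B → C → D) {a a′ b b′ c c′} →
        a ≡ a′ → b ≡ b′ → c ≡ c′ → f a b c ≡ f a′ b′ c′
cong₃ f refl refl refl = refl

ℚ-of-+ : ∀ a b → ℚ-of (a ℕ.+ b) ≡ ℚ-of a + ℚ-of b
ℚ-of-+ a b = toℚᵘ-injective (begin
  toℚᵘ (ℚ-of (a ℕ.+ b))                 ≈⟨ toℚᵘ-fromℚᵘ (ℚᵘ.mkℚᵘ (+ (a ℕ.+ b)) 0) ⟩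
  ℚᵘ.mkℚᵘ (+ (a ℕ.+ b)) 0               ≈⟨ ℚᵘ.*≡* (trans (cong (ℤ._* (+ 1 ℤ.* + 1)) (ℤₚ.pos-+ a b))
                                                         (over-one (+ a) (+ b))) ⟩
  ℚᵘ.mkℚᵘ (+ a) 0 ℚᵘ.+ ℚᵘ.mkℚᵘ (+ b) 0  ≈⟨ ℚᵘ.+-cong (toℚᵘ-fromℚᵘ (ℚᵘ.mkℚᵘ (+ a) 0))
                                                     (toℚᵘ-fromℚᵘ (ℚᵘ.mkℚᵘ (+ b) 0)) ⟨
  toℚᵘ (ℚ-of a) ℚᵘ.+ toℚᵘ (ℚ-of b)      ≈⟨ toℚᵘ-homo-+ (ℚ-of a) (ℚ-of b) ⟨
  toℚᵘ (ℚ-of a + ℚ-of b)                ∎)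
  where
  open ℚᵘ.≃-Reasoning
  over-one : ∀ x y → (x ℤ.+ y) ℤ.* (+ 1 ℤ.* + 1) ≡ (x ℤ.* + 1 ℤ.+ y ℤ.* + 1) ℤ.* + 1
  over-one = solve-∀

ℚ-of-* : ∀ a b → ℚ-of (a ℕ.* b) ≡ ℚ-of a * ℚ-of b
ℚ-of-* a b = toℚᵘ-injective (begin
  toℚᵘ (ℚ-of (a ℕ.* b))                 ≈⟨ toℚᵘ-fromℚᵘ (ℚᵘ.mkℚᵘ (+ (a ℕ.* b)) 0) ⟩
  ℚᵘ.mkℚᵘ (+ (a ℕ.* b)) 0               ≈⟨ ℚᵘ.*≡* (trans (cong (ℤ._* (+ 1 ℤ.* + 1)) (ℤₚ.pos-* a b))
                                                         (over-one (+ a) (+ b))) ⟩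
  ℚᵘ.mkℚᵘ (+ a) 0 ℚᵘ.* ℚᵘ.mkℚᵘ (+ b) 0  ≈⟨ ℚᵘ.*-cong (toℚᵘ-fromℚᵘ (ℚᵘ.mkℚᵘ (+ a) 0))
                                                     (toℚᵘ-fromℚᵘ (ℚᵘ.mkℚᵘ (+ b) 0)) ⟨
  toℚᵘ (ℚ-of a) ℚᵘ.* toℚᵘ (ℚ-of b)      ≈⟨ toℚᵘ-homo-* (ℚ-of a) (ℚ-of b) ⟨
  toℚᵘ (ℚ-of a * ℚ-of b)                ∎)
  where
  open ℚᵘ.≃-Reasoning
  over-one : ∀ x y → (x ℤ.* y) ℤ.* (+ 1 ℤ.* + 1) ≡ (x ℤ.* y) ℤ.* + 1
  over-one = solve-∀

δ : ℕ → ℕ → ℚ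
δ a b = if does (a ≟ b) then 1ℚ else 0ℚ

δ-≡ : ∀ {a b} → a ≡ b → δ a b ≡ 1ℚ
δ-≡ {a} {b} a≡b rewrite dec-true (a ≟ b) a≡b = refl

δ-≢ : ∀ {a b} → a ≢ b → δ a b ≡ 0ℚ
δ-≢ {a} {b} a≢b rewrite dec-false (a ≟ b) a≢b = refl

δ-⇔ : ∀ {a b c d} → (a ≡ b → c ≡ d) → (c ≡ d → a ≡ b) → δ a b ≡ δ c d
δ-⇔ {a} {b} to from with a ≟ b
... | yes a≡b = trans (δ-≡ a≡b) (sym (δ-≡ (to a≡b)))
... | no  a≢b = trans (δ-≢ a≢b) (sym (δ-≢ (a≢b ∘ from)))

δ-∨ : ∀ {a b} x → a ≢ b → (if does (x ≟ a) ∨ does (x ≟ b) then 1ℚ else 0ℚ) ≡ δ x a + δ x b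
δ-∨ {a} {b} x a≢b with x ≟ a | x ≟ b
... | yes refl | yes refl = contradiction refl a≢b
... | yes x≡a  | no  x≢b
  rewrite dec-true (x ≟ a) x≡a | dec-false (x ≟ b) x≢b = refl
... | no  x≢a  | yes x≡b
  rewrite dec-false (x ≟ a) x≢a | dec-true (x ≟ b) x≡b = refl
... | no  x≢a  | no  x≢b
  rewrite dec-false (x ≟ a) x≢a | dec-false (x ≟ b) x≢b = refl

Σℕ-cong : ∀ N {f g : ℕ → ℚ} → (∀ t → t < N → f t ≡ g t) → Σℕ N f ≡ Σℕ N g
Σℕ-cong zero    f≗g = refl
Σℕ-cong (suc N) f≗g = cong₂ _+_ (Σℕ-cong N (λ t t<N → f≗g t (ℕₚ.m<n⇒m<1+n t<N))) (f≗g N (ℕₚ.n<1+n N))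

Σℕ-+ : ∀ N (f g : ℕ → ℚ) → Σℕ N (λ t → f t + g t) ≡ Σℕ N f + Σℕ N g
Σℕ-+ zero    f g = refl
Σℕ-+ (suc N) f g = trans (cong (_+ (f N + g N)) (Σℕ-+ N f g)) (interchange (Σℕ N f) (Σℕ N g) (f N) (g N))
  where
  interchange : ∀ a b c d → (a + b) + (c + d) ≡ (a + c) + (b + d)
  interchange = solve 4 (λ a b c d → (a :+ b) :+ (c :+ d) := (a :+ c) :+ (b :+ d)) refl

Σℕ-- : ∀ N (f g : ℕ → ℚ) → Σℕ N (λ t → f t - g t) ≡ Σℕ N f - Σℕ N g
Σℕ-- zero    f g = refl
Σℕ-- (suc N) f g = trans (cong (_+ (f N - g N)) (Σℕ-- N f g)) (interchange (Σℕ N f) (Σℕ N g) (f N) (g N))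
  where
  interchange : ∀ a b c d → (a - b) + (c - d) ≡ (a + c) - (b + d)
  interchange = solve 4 (λ a b c d → (a :- b) :+ (c :- d) := (a :+ c) :- (b :+ d)) refl

Σℕ-*ˡ : ∀ N c (f : ℕ → ℚ) → Σℕ N (λ t → c * f t) ≡ c * Σℕ N f
Σℕ-*ˡ zero    c f = sym (*-zeroʳ c)
Σℕ-*ˡ (suc N) c f = trans (cong (_+ c * f N) (Σℕ-*ˡ N c f)) (sym (*-distribˡ-+ c (Σℕ N f) (f N)))

Σℕ-front : ∀ N (f : ℕ → ℚ) → Σℕ (suc N) f ≡ f 0 + Σℕ N (f ∘ suc)
Σℕ-front zero    f = trans (+-identityˡ (f 0)) (sym (+-identityʳ (f 0)))
Σℕ-front (suc N) f = trans (cong (_+ f (suc N)) (Σℕ-front N f)) (+-assoc (f 0) (Σℕ N (f ∘ suc)) (f (suc N)))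

Σℕ-δ : ∀ N a (f : ℕ → ℚ) → a < N → Σℕ N (λ t → δ t a * f t) ≡ f a
Σℕ-δ (suc N) zero f _ = begin
  Σℕ (suc N) (λ t → δ t 0 * f t)              ≡⟨ Σℕ-front N (λ t → δ t 0 * f t) ⟩
  1ℚ * f 0 + Σℕ N (λ t → 0ℚ * f (suc t))      ≡⟨ cong₂ _+_ (*-identityˡ (f 0))
                                                   (trans (Σℕ-*ˡ N 0ℚ (f ∘ suc)) (*-zeroˡ (Σℕ N (f ∘ suc)))) ⟩
  f 0 + 0ℚ                                    ≡⟨ +-identityʳ (f 0) ⟩
  f 0                                         ∎
  where open ≡-Reasoning
Σℕ-δ (suc N) (suc a) f (s≤s a<N) = begin
  Σℕ (suc N) (λ t → δ t (suc a) * f t)        ≡⟨ Σℕ-front N (λ t → δ t (suc a) * f t) ⟩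
  0ℚ * f 0 + Σℕ N (λ t → δ t a * f (suc t))   ≡⟨ cong₂ _+_ (*-zeroˡ (f 0)) (Σℕ-δ N a (f ∘ suc) a<N) ⟩
  0ℚ + f (suc a)                              ≡⟨ +-identityˡ (f (suc a)) ⟩
  f (suc a)                                   ∎
  where open ≡-Reasoning

Σℕ-palindrome : ∀ m (f : ℕ → ℚ) →
  Σℕ m (λ t → f (suc t) + f (m ℕ.* 2 ∸ t)) ≡ Σℕ (m ℕ.* 2) (f ∘ suc)
Σℕ-palindrome zero    f = refl
Σℕ-palindrome (suc m) f = begin
  Σℕ (suc m) (λ t → f (suc t) + f (suc (suc p) ∸ t))
    ≡⟨ Σℕ-front m (λ t → f (suc t) + f (suc (suc p) ∸ t)) ⟩
  (f 1 + f (suc (suc p))) + Σℕ m (λ t → f (suc (suc t)) + f (suc p ∸ t))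
    ≡⟨ cong (_+_ (f 1 + f (suc (suc p)))) (Σℕ-cong m (λ t t<m →
         cong (λ i → f (suc (suc t)) + f i) (ℕₚ.+-∸-assoc 1 (t≤p t<m)))) ⟩
  (f 1 + f (suc (suc p))) + Σℕ m (λ t → f (suc (suc t)) + f (suc (p ∸ t)))
    ≡⟨ cong (_+_ (f 1 + f (suc (suc p)))) (Σℕ-palindrome m (f ∘ suc)) ⟩
  (f 1 + f (suc (suc p))) + Σℕ p (f ∘ suc ∘ suc)
    ≡⟨ rearrange (f 1) (f (suc (suc p))) (Σℕ p (f ∘ suc ∘ suc)) ⟩
  f 1 + Σℕ (suc p) (f ∘ suc ∘ suc)
    ≡⟨ Σℕ-front (suc p) (f ∘ suc) ⟨
  Σℕ (suc (suc p)) (f ∘ suc)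
    ∎
  where
  open ≡-Reasoning
  p = m ℕ.* 2
  t≤p : ∀ {t} → t < m → t ≤ p
  t≤p t<m = ℕₚ.≤-trans (ℕₚ.<⇒≤ t<m) (ℕₚ.m≤m*n m 2)
  rearrange : ∀ a b s → (a + b) + s ≡ a + (s + b)
  rearrange = solve 3 (λ a b s → (a :+ b) :+ s := a :+ (s :+ b)) refl

ΣFin-toℕ : ∀ μ (f : ℕ → ℚ) → ΣFin μ (λ l → f (toℕ l)) ≡ Σℕ μ f
ΣFin-toℕ zero    f = refl
ΣFin-toℕ (suc μ) f = trans (cong (_+_ (f 0)) (ΣFin-toℕ μ (f ∘ suc))) (sym (Σℕ-front μ f))

-- (j − k) mod μ without truncated subtraction (for k ≤ μ): Circ s reads s at this index
-- in row k, column j.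
subMod : (μ : ℕ) .{{_ : ℕ.NonZero μ}} → ℕ → ℕ → ℕ
subMod μ j k = (j ℕ.+ (μ ∸ k)) % μ

module _ {μ : ℕ} .{{_ : ℕ.NonZero μ}} where

  subMod-≤ : ∀ {j k} → k ≤ j → j < μ → subMod μ j k ≡ j ∸ k
  subMod-≤ {j} {k} k≤j j<μ = begin
    (j ℕ.+ (μ ∸ k)) % μ   ≡⟨ cong (_% μ) (ℕₚ.+-∸-assoc j k≤μ) ⟨
    (j ℕ.+ μ ∸ k) % μ     ≡⟨ cong (_% μ) (ℕₚ.+-∸-comm μ k≤j) ⟩
    (j ∸ k ℕ.+ μ) % μ     ≡⟨ [m+n]%n≡m%n (j ∸ k) μ ⟩
    (j ∸ k) % μ           ≡⟨ m<n⇒m%n≡m (ℕₚ.≤-<-trans (ℕₚ.m∸n≤m j k) j<μ) ⟩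
    j ∸ k                 ∎
    where
    open ≡-Reasoning
    k≤μ = ℕₚ.≤-trans k≤j (ℕₚ.<⇒≤ j<μ)

  subMod-> : ∀ {j k} → j < k → k ≤ μ → subMod μ j k ≡ j ℕ.+ (μ ∸ k)
  subMod-> {j} {k} j<k k≤μ = m<n⇒m%n≡m (ℕₚ.<-≤-trans (ℕₚ.+-monoˡ-< (μ ∸ k) j<k)
                                                     (ℕₚ.≤-reflexive (ℕₚ.m+[n∸m]≡n k≤μ)))

  subMod-0 : ∀ {j} → j < μ → subMod μ j 0 ≡ j
  subMod-0 = subMod-≤ z≤n

  subMod-succ : ∀ {j} → suc j < μ → subMod μ j (μ ∸ 1) ≡ suc j
  subMod-succ {j} sj<μ = begin
    subMod μ j (μ ∸ 1)      ≡⟨ subMod-> (ℕₚ.<⇒≤pred sj<μ) (ℕₚ.m∸n≤m μ 1) ⟩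
    j ℕ.+ (μ ∸ (μ ∸ 1))     ≡⟨ cong (j ℕ.+_) (ℕₚ.m∸[m∸n]≡n (ℕₚ.≤-trans (s≤s z≤n) sj<μ)) ⟩
    j ℕ.+ 1                 ≡⟨ ℕₚ.+-comm j 1 ⟩
    suc j                   ∎
    where open ≡-Reasoning

  subMod-involutive : ∀ {j c} → j < μ → c < μ → subMod μ j (subMod μ j c) ≡ c
  subMod-involutive {j} {c} j<μ c<μ with c ℕ.≤? j
  ... | yes c≤j = begin
    subMod μ j (subMod μ j c)  ≡⟨ cong (subMod μ j) (subMod-≤ c≤j j<μ) ⟩
    subMod μ j (j ∸ c)         ≡⟨ subMod-≤ (ℕₚ.m∸n≤m j c) j<μ ⟩
    j ∸ (j ∸ c)                ≡⟨ ℕₚ.m∸[m∸n]≡n c≤j ⟩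
    c                          ∎
    where open ≡-Reasoning
  ... | no c≰j = begin
    subMod μ j (subMod μ j c)        ≡⟨ cong (subMod μ j) (subMod-> j<c c≤μ) ⟩
    subMod μ j (j ℕ.+ (μ ∸ c))       ≡⟨ subMod-> (ℕₚ.m<m+n j (ℕₚ.m<n⇒0<n∸m c<μ)) j+[μ∸c]≤μ ⟩
    j ℕ.+ (μ ∸ (j ℕ.+ (μ ∸ c)))      ≡⟨ cong (j ℕ.+_) μ∸[j+[μ∸c]]≡c∸j ⟩
    j ℕ.+ (c ∸ j)                    ≡⟨ ℕₚ.m+[n∸m]≡n (ℕₚ.<⇒≤ j<c) ⟩
    c                                ∎
    where
    open ≡-Reasoning
    j<c = ℕₚ.≰⇒> c≰j
    c≤μ = ℕₚ.<⇒≤ c<μ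
    j+[μ∸c]≤μ : j ℕ.+ (μ ∸ c) ≤ μ
    j+[μ∸c]≤μ = ℕₚ.≤-trans (ℕₚ.+-monoˡ-≤ (μ ∸ c) (ℕₚ.<⇒≤ j<c)) (ℕₚ.≤-reflexive (ℕₚ.m+[n∸m]≡n c≤μ))
    μ∸[j+[μ∸c]]≡c∸j : μ ∸ (j ℕ.+ (μ ∸ c)) ≡ c ∸ j
    μ∸[j+[μ∸c]]≡c∸j = begin
      μ ∸ (j ℕ.+ (μ ∸ c))  ≡⟨ cong (μ ∸_) (ℕₚ.+-comm j (μ ∸ c)) ⟩
      μ ∸ ((μ ∸ c) ℕ.+ j)  ≡⟨ ℕₚ.∸-+-assoc μ (μ ∸ c) j ⟨
      μ ∸ (μ ∸ c) ∸ j      ≡⟨ cong (_∸ j) (ℕₚ.m∸[m∸n]≡n c≤μ) ⟩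
      c ∸ j                ∎

  δ-subMod : ∀ {j k c} → j < μ → k < μ → c < μ → δ (subMod μ j k) c ≡ δ k (subMod μ j c)
  δ-subMod {j} {k} {c} j<μ k<μ c<μ = δ-⇔
    (λ j-k≡c → trans (sym (subMod-involutive j<μ k<μ)) (cong (subMod μ j) j-k≡c))
    (λ k≡j-c → trans (cong (subMod μ j) k≡j-c) (subMod-involutive j<μ c<μ))

sgn-even : ∀ m → sgn (m ℕ.* 2) ≡ 1ℚ
sgn-even zero    = refl
sgn-even (suc m) = trans (neg-involutive (sgn (m ℕ.* 2))) (sgn-even m)

coeff : ℚ → ℕ → ℚ
coeff M k = sgn k * ((M - ℚ-of (2 ℕ.* k)) * ½)

coeff-0 : ∀ M → coeff M 0 ≡ M * ½
coeff-0 = solve 1 (λ M → con 1ℚ :* ((M :- con (ℚ-of 0)) :* con ½) := M :* con ½) refl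

coeff-pair : ∀ M k → coeff M k + coeff M (suc k) ≡ sgn k
coeff-pair M k = begin
  coeff M k + coeff M (suc k)
    ≡⟨ cong (λ x → coeff M k + (- sgn k) * ((M - x) * ½))
            (trans (cong ℚ-of (ℕₚ.*-suc 2 k)) (ℚ-of-+ 2 (2 ℕ.* k))) ⟩
  sgn k * ((M - ℚ-of (2 ℕ.* k)) * ½) + (- sgn k) * ((M - (ℚ-of 2 + ℚ-of (2 ℕ.* k))) * ½)
    ≡⟨ telescope (sgn k) M (ℚ-of (2 ℕ.* k)) ⟩
  sgn k ∎
  where
  open ≡-Reasoning
  telescope : ∀ σ M T → σ * ((M - T) * ½) + (- σ) * ((M - (ℚ-of 2 + T)) * ½) ≡ σ
  telescope = solve 3 (λ σ M T → σ :* ((M :- T) :* con ½) :+ (:- σ) :* ((M :- (con (ℚ-of 2) :+ T)) :* con ½)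
                                 := σ) refl

Σ-coeff : ∀ M m → Σℕ (suc (m ℕ.* 2)) (coeff M) ≡ coeff M 0 - ℚ-of m
Σ-coeff M zero    = solve 1 (λ a → con 0ℚ :+ a := a :- con (ℚ-of 0)) refl (coeff M 0)
Σ-coeff M (suc m) = begin
  Σℕ (suc p) (coeff M) + coeff M (suc p) + coeff M (suc (suc p))
    ≡⟨ +-assoc (Σℕ (suc p) (coeff M)) (coeff M (suc p)) (coeff M (suc (suc p))) ⟩
  Σℕ (suc p) (coeff M) + (coeff M (suc p) + coeff M (suc (suc p)))
    ≡⟨ cong₂ _+_ (Σ-coeff M m) (coeff-pair M (suc p)) ⟩
  (coeff M 0 - ℚ-of m) + - sgn p
    ≡⟨ cong (λ σ → (coeff M 0 - ℚ-of m) + - σ) (sgn-even m) ⟩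
  (coeff M 0 - ℚ-of m) + - 1ℚ
    ≡⟨ step (coeff M 0) (ℚ-of m) ⟩
  coeff M 0 - (ℚ-of 1 + ℚ-of m)
    ≡⟨ cong (_-_ (coeff M 0)) (ℚ-of-+ 1 m) ⟨
  coeff M 0 - ℚ-of (suc m) ∎
  where
  open ≡-Reasoning
  p = m ℕ.* 2
  step : ∀ a x → (a - x) + - 1ℚ ≡ a - (ℚ-of 1 + x)
  step = solve 2 (λ a x → (a :- x) :+ :- con 1ℚ := a :- (con (ℚ-of 1) :+ x)) refl

-- vvec n j unfolds to vEntry (n ∸ 2) (toℕ j).
vEntry : ℕ → ℕ → ℚ
vEntry p x = if does (x ≟ 0) then 0ℚ else if does (x ≟ 1) ∨ does (x ≟ p) then 1ℚ else ℚ-of 2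

vEntry-δ : ∀ {p} x → 2 ≤ p → vEntry p x ≡ ℚ-of 2 - (ℚ-of 2 * δ x 0 + δ x 1 + δ x p)
vEntry-δ {suc zero}    _             (s≤s ())
vEntry-δ {suc (suc p)} zero          _ = refl
vEntry-δ {suc (suc p)} (suc zero)    _ = refl
vEntry-δ {suc (suc p)} (suc (suc x)) _ with does (x ≟ p)
... | true  = refl
... | false = refl

vEntry-subMod : ∀ {p j k} → 2 ≤ p → j < suc p → k < suc p →
  vEntry p (subMod (suc p) j k)
    ≡ ℚ-of 2 - (ℚ-of 2 * δ k j + δ k (subMod (suc p) j 1) + δ k (subMod (suc p) j p))
vEntry-subMod {p} {j} {k} 2≤p j<μ k<μ = trans (vEntry-δ (subMod μ j k) 2≤p)
  (cong₃ (λ a b c → ℚ-of 2 - (ℚ-of 2 * a + b + c))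
         (trans (δ-subMod j<μ k<μ z<s) (cong (δ k) (subMod-0 j<μ)))
         (δ-subMod j<μ k<μ (s≤s (ℕₚ.≤-trans (s≤s z≤n) 2≤p)))
         (δ-subMod j<μ k<μ (ℕₚ.n<1+n p)))
  where μ = suc p

Σ-vEntry : ∀ p (f : ℕ → ℚ) {j} → 2 ≤ p → j < suc p →
  Σℕ (suc p) (λ k → f k * vEntry p (subMod (suc p) j k))
    ≡ ℚ-of 2 * Σℕ (suc p) f - (ℚ-of 2 * f j + f (subMod (suc p) j 1) + f (subMod (suc p) j p))
Σ-vEntry p f {j} 2≤p j<μ = begin
  Σℕ μ (λ k → f k * vEntry p (subMod μ j k))
    ≡⟨ Σℕ-cong μ (λ k k<μ → trans (cong (f k *_) (vEntry-subMod 2≤p j<μ k<μ))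
                                 (distribute (f k) (δ k j) (δ k j⁻) (δ k j⁺))) ⟩
  Σℕ μ (λ k → ℚ-of 2 * f k - (ℚ-of 2 * (δ k j * f k) + δ k j⁻ * f k + δ k j⁺ * f k))
    ≡⟨ Σℕ-- μ (λ k → ℚ-of 2 * f k) _ ⟩
  Σℕ μ (λ k → ℚ-of 2 * f k) - Σℕ μ (λ k → ℚ-of 2 * (δ k j * f k) + δ k j⁻ * f k + δ k j⁺ * f k)
    ≡⟨ cong₂ _-_ (Σℕ-*ˡ μ (ℚ-of 2) f) select ⟩
  ℚ-of 2 * Σℕ μ f - (ℚ-of 2 * f j + f j⁻ + f j⁺)
    ∎
  where
  open ≡-Reasoning
  μ = suc p
  j⁻ = subMod μ j 1
  j⁺ = subMod μ j p
  distribute : ∀ F a b c → F * (ℚ-of 2 - (ℚ-of 2 * a + b + c))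
                         ≡ ℚ-of 2 * F - (ℚ-of 2 * (a * F) + b * F + c * F)
  distribute = solve 4 (λ F a b c → F :* (con (ℚ-of 2) :- (con (ℚ-of 2) :* a :+ b :+ c))
                                    := con (ℚ-of 2) :* F :- (con (ℚ-of 2) :* (a :* F) :+ b :* F :+ c :* F)) refl
  select : Σℕ μ (λ k → ℚ-of 2 * (δ k j * f k) + δ k j⁻ * f k + δ k j⁺ * f k) ≡ ℚ-of 2 * f j + f j⁻ + f j⁺
  select = begin
    Σℕ μ (λ k → ℚ-of 2 * (δ k j * f k) + δ k j⁻ * f k + δ k j⁺ * f k)
      ≡⟨ Σℕ-+ μ (λ k → ℚ-of 2 * (δ k j * f k) + δ k j⁻ * f k) (λ k → δ k j⁺ * f k) ⟩
    Σℕ μ (λ k → ℚ-of 2 * (δ k j * f k) + δ k j⁻ * f k) + Σℕ μ (λ k → δ k j⁺ * f k)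
      ≡⟨ cong (_+ Σℕ μ (λ k → δ k j⁺ * f k)) (Σℕ-+ μ (λ k → ℚ-of 2 * (δ k j * f k)) (λ k → δ k j⁻ * f k)) ⟩
    Σℕ μ (λ k → ℚ-of 2 * (δ k j * f k)) + Σℕ μ (λ k → δ k j⁻ * f k) + Σℕ μ (λ k → δ k j⁺ * f k)
      ≡⟨ cong₃ (λ a b c → a + b + c)
               (trans (Σℕ-*ˡ μ (ℚ-of 2) (λ k → δ k j * f k)) (cong (ℚ-of 2 *_) (Σℕ-δ μ j f j<μ)))
               (Σℕ-δ μ j⁻ f (m%n<n (j ℕ.+ (μ ∸ 1)) μ))
               (Σℕ-δ μ j⁺ f (m%n<n (j ℕ.+ (μ ∸ p)) μ)) ⟩
    ℚ-of 2 * f j + f j⁻ + f j⁺ ∎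

regroup : ∀ a b c → ℚ-of 2 * b + a + c ≡ (a + b) + (b + c)
regroup = solve 3 (λ a b c → con (ℚ-of 2) :* b :+ a :+ c := (a :+ b) :+ (b :+ c)) refl

module OddCycle (m : ℕ) where

  n p μ : ℕ
  n = suc m ℕ.* 2
  p = m ℕ.* 2
  μ = suc p

  M : ℚ
  M = ℚ-of μ

  sgn-odd-sum : ∀ j k → j ℕ.+ k ≡ μ → sgn j ≡ - sgn k
  sgn-odd-sum zero    .μ refl = sym (trans (neg-involutive (sgn p)) (sgn-even m))
  sgn-odd-sum (suc j) k eq =
    cong -_ (trans (sgn-odd-sum j (suc k) (trans (ℕₚ.+-suc j k) eq)) (neg-involutive (sgn k)))

  coeff-reflect : ∀ j k → j ℕ.+ k ≡ μ → coeff M j ≡ coeff M k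
  coeff-reflect j k eq = begin
    sgn j * ((M - ℚ-of (2 ℕ.* j)) * ½)
      ≡⟨ cong₃ (λ σ X Y → σ * ((X - Y) * ½))
               (sgn-odd-sum j k eq) (trans (cong ℚ-of (sym eq)) (ℚ-of-+ j k)) (ℚ-of-* 2 j) ⟩
    (- sgn k) * ((ℚ-of j + ℚ-of k - ℚ-of 2 * ℚ-of j) * ½)
      ≡⟨ swap (sgn k) (ℚ-of j) (ℚ-of k) ⟩
    sgn k * ((ℚ-of j + ℚ-of k - ℚ-of 2 * ℚ-of k) * ½)
      ≡⟨ cong₂ (λ X Y → sgn k * ((X - Y) * ½)) (trans (cong ℚ-of (sym eq)) (ℚ-of-+ j k)) (ℚ-of-* 2 k) ⟨
    sgn k * ((M - ℚ-of (2 ℕ.* k)) * ½) ∎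
    where
    open ≡-Reasoning
    swap : ∀ σ J K → (- σ) * ((J + K - ℚ-of 2 * J) * ½) ≡ σ * ((J + K - ℚ-of 2 * K) * ½)
    swap = solve 3 (λ σ J K → (:- σ) :* ((J :+ K :- con (ℚ-of 2) :* J) :* con ½)
                              := σ :* ((J :+ K :- con (ℚ-of 2) :* K) :* con ½)) refl

  Σ-coeff-odd : Σℕ μ (coeff M) ≡ ½
  Σ-coeff-odd = begin
    Σℕ μ (coeff M)                    ≡⟨ Σ-coeff M m ⟩
    coeff M 0 - ℚ-of m                ≡⟨ cong (_- ℚ-of m) (coeff-0 M) ⟩
    M * ½ - ℚ-of m                    ≡⟨ cong (λ X → X * ½ - ℚ-of m) (trans (ℚ-of-+ 1 p) (cong (_+_ (ℚ-of 1)) (ℚ-of-* m 2))) ⟩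
    (ℚ-of 1 + ℚ-of m * ℚ-of 2) * ½ - ℚ-of m  ≡⟨ halve (ℚ-of m) ⟩
    ½                                 ∎
    where
    open ≡-Reasoning
    halve : ∀ x → (ℚ-of 1 + x * ℚ-of 2) * ½ - x ≡ ½
    halve = solve 1 (λ x → (con (ℚ-of 1) :+ x :* con (ℚ-of 2)) :* con ½ :- x := con ½) refl

  2≤p : 1 ≤ m → 2 ≤ p
  2≤p = ℕₚ.*-monoˡ-≤ 2

  coeff-neighbours : 1 ≤ m → ∀ {j} → j < μ →
    ℚ-of 2 * coeff M j + coeff M (subMod μ j 1) + coeff M (subMod μ j p) ≡ ℚ-of 2 * δ j 0
  coeff-neighbours 1≤m {zero} _ = begin
    ℚ-of 2 * c 0 + c (subMod μ 0 1) + c (subMod μ 0 p)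
      ≡⟨ cong₂ (λ a b → ℚ-of 2 * c 0 + c a + c b)
               (subMod-> {μ} z<s (s≤s z≤n)) (subMod-succ (s≤s (ℕₚ.<⇒≤ (2≤p 1≤m)))) ⟩
    ℚ-of 2 * c 0 + c p + c 1   ≡⟨ cong (λ x → ℚ-of 2 * c 0 + x + c 1) (coeff-reflect p 1 (ℕₚ.+-comm p 1)) ⟩
    ℚ-of 2 * c 0 + c 1 + c 1   ≡⟨ double (c 0) (c 1) ⟩
    ℚ-of 2 * (c 0 + c 1)       ≡⟨ cong (ℚ-of 2 *_) (coeff-pair M 0) ⟩
    ℚ-of 2 * 1ℚ                ∎
    where
    open ≡-Reasoning
    c = coeff M
    double : ∀ a b → ℚ-of 2 * a + b + b ≡ ℚ-of 2 * (a + b)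
    double = solve 2 (λ a b → con (ℚ-of 2) :* a :+ b :+ b := con (ℚ-of 2) :* (a :+ b)) refl
  coeff-neighbours 1≤m {suc j} sj<μ with ℕₚ.m≤n⇒m<n∨m≡n (ℕₚ.≤-pred sj<μ)
  ... | inj₁ sj<p = begin
    ℚ-of 2 * c (suc j) + c (subMod μ (suc j) 1) + c (subMod μ (suc j) p)
      ≡⟨ cong₂ (λ a b → ℚ-of 2 * c (suc j) + c a + c b)
               (subMod-≤ (s≤s z≤n) sj<μ)
               (subMod-succ (s≤s sj<p)) ⟩
    ℚ-of 2 * c (suc j) + c j + c (suc (suc j))
      ≡⟨ regroup (c j) (c (suc j)) (c (suc (suc j))) ⟩
    (c j + c (suc j)) + (c (suc j) + c (suc (suc j)))
      ≡⟨ cong₂ _+_ (coeff-pair M j) (coeff-pair M (suc j)) ⟩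
    sgn j + - sgn j            ≡⟨ +-inverseʳ (sgn j) ⟩
    0ℚ                         ∎
    where
    open ≡-Reasoning
    c = coeff M
  ... | inj₂ sj≡p = begin
    ℚ-of 2 * c (suc j) + c (subMod μ (suc j) 1) + c (subMod μ (suc j) p)
      ≡⟨ cong₂ (λ a b → ℚ-of 2 * c (suc j) + c a + c b)
               (subMod-≤ (s≤s z≤n) sj<μ)
               (trans (subMod-≤ (ℕₚ.≤-reflexive (sym sj≡p)) sj<μ)
                      (trans (cong (suc j ∸_) (sym sj≡p)) (ℕₚ.n∸n≡0 (suc j)))) ⟩
    ℚ-of 2 * c (suc j) + c j + c 0
      ≡⟨ cong₂ (λ a b → ℚ-of 2 * a + b + c 0)
               (coeff-reflect (suc j) 1 (trans (ℕₚ.+-comm (suc j) 1) (cong suc sj≡p)))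
               (coeff-reflect j 2 (trans (ℕₚ.+-comm j 2) (cong suc sj≡p))) ⟩
    ℚ-of 2 * c 1 + c 2 + c 0
      ≡⟨ regroup (c 2) (c 1) (c 0) ⟩
    (c 2 + c 1) + (c 1 + c 0)
      ≡⟨ cong₂ _+_ (trans (+-comm (c 2) (c 1)) (coeff-pair M 1))
                   (trans (+-comm (c 1) (c 0)) (coeff-pair M 0)) ⟩
    - 1ℚ + 1ℚ                  ≡⟨ +-inverseˡ 1ℚ ⟩
    0ℚ                         ∎
    where
    open ≡-Reasoning
    c = coeff M

  rowTimes-cvec-Dtilde : ∀ k (y : Fin μ) → 1 ≤ k → k ≤ m →
    rowTimes (cvec n k) (Dtilde n) y ≡ vEntry p (subMod μ (toℕ y) k) + vEntry p (subMod μ (toℕ y) (μ ∸ k))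
  rowTimes-cvec-Dtilde k y 1≤k k≤m = begin
    ΣFin μ (λ l → F (toℕ l))                              ≡⟨ ΣFin-toℕ μ F ⟩
    Σℕ μ F                                                ≡⟨ Σℕ-cong μ (λ x _ → split x) ⟩
    Σℕ μ (λ x → δ x k * W x + δ x (μ ∸ k) * W x)          ≡⟨ Σℕ-+ μ (λ x → δ x k * W x) (λ x → δ x (μ ∸ k) * W x) ⟩
    Σℕ μ (λ x → δ x k * W x) + Σℕ μ (λ x → δ x (μ ∸ k) * W x)
      ≡⟨ cong₂ _+_ (Σℕ-δ μ k W k<μ) (Σℕ-δ μ (μ ∸ k) W μ∸k<μ) ⟩
    W k + W (μ ∸ k)                                       ∎
    where
    open ≡-Reasoning
    W : ℕ → ℚ
    W x = vEntry p (subMod μ (toℕ y) x)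
    F : ℕ → ℚ
    F x = (if does (x ≟ k) ∨ does (x ≟ μ ∸ k) then 1ℚ else 0ℚ)
        * vEntry p (toℕ ((toℕ y ℕ.+ (μ ∸ x)) mod μ))
    k≤p : k ≤ p
    k≤p = ℕₚ.≤-trans k≤m (ℕₚ.m≤m*n m 2)
    k<μ : k < μ
    k<μ = s≤s k≤p
    μ∸k<μ : μ ∸ k < μ
    μ∸k<μ = ℕₚ.∸-monoʳ-< 1≤k (ℕₚ.<⇒≤ k<μ)
    k+k≤p : k ℕ.+ k ≤ p
    k+k≤p = ℕₚ.≤-trans (ℕₚ.+-mono-≤ k≤m k≤m)
                       (ℕₚ.≤-reflexive (trans (cong (m ℕ.+_) (sym (ℕₚ.+-identityʳ m))) (ℕₚ.*-comm 2 m)))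
    k≢μ∸k : k ≢ μ ∸ k
    k≢μ∸k eq = ℕₚ.<⇒≢ (s≤s k+k≤p) (trans (cong (k ℕ.+_) eq) (ℕₚ.m+[n∸m]≡n (ℕₚ.<⇒≤ k<μ)))
    split : ∀ x → F x ≡ δ x k * W x + δ x (μ ∸ k) * W x
    split x = trans (cong₂ _*_ (δ-∨ x k≢μ∸k) (cong (vEntry p) (toℕ-fromℕ< (m%n<n (toℕ y ℕ.+ (μ ∸ x)) μ))))
                    (*-distribʳ-+ (W x) (δ x k) (δ x (μ ∸ k)))

  convolution : ℕ → ℕ → ℚ
  convolution j k = coeff M k * vEntry p (subMod μ j k)

  Σ-coeff-rowTimes : (y : Fin μ) →
    Σℕ (n ℕ./ 2 ∸ 1) (λ t → coeff M (suc t) * rowTimes (cvec n (suc t)) (Dtilde n) y)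
      ≡ Σℕ p (convolution (toℕ y) ∘ suc)
  Σ-coeff-rowTimes y = begin
    Σℕ (n ℕ./ 2 ∸ 1) (λ t → coeff M (suc t) * rowTimes (cvec n (suc t)) (Dtilde n) y)
      ≡⟨ cong (λ N → Σℕ N (λ t → coeff M (suc t) * rowTimes (cvec n (suc t)) (Dtilde n) y))
              (cong (_∸ 1) (m*n/n≡m (suc m) 2)) ⟩
    Σℕ m (λ t → coeff M (suc t) * rowTimes (cvec n (suc t)) (Dtilde n) y)
      ≡⟨ Σℕ-cong m paired ⟩
    Σℕ m (λ t → h (suc t) + h (p ∸ t))
      ≡⟨ Σℕ-palindrome m h ⟩
    Σℕ p (h ∘ suc) ∎
    where
    open ≡-Reasoning
    h = convolution (toℕ y)
    paired : ∀ t → t < m → coeff M (suc t) * rowTimes (cvec n (suc t)) (Dtilde n) y ≡ h (suc t) + h (p ∸ t)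
    paired t t<m = begin
      coeff M (suc t) * rowTimes (cvec n (suc t)) (Dtilde n) y
        ≡⟨ cong (coeff M (suc t) *_) (rowTimes-cvec-Dtilde (suc t) y (s≤s z≤n) t<m) ⟩
      coeff M (suc t) * (vEntry p (subMod μ (toℕ y) (suc t)) + vEntry p (subMod μ (toℕ y) (p ∸ t)))
        ≡⟨ *-distribˡ-+ (coeff M (suc t)) _ _ ⟩
      h (suc t) + coeff M (suc t) * vEntry p (subMod μ (toℕ y) (p ∸ t))
        ≡⟨ cong (λ c → h (suc t) + c * vEntry p (subMod μ (toℕ y) (p ∸ t)))
                (coeff-reflect (suc t) (p ∸ t) (cong suc (ℕₚ.m+[n∸m]≡n t≤p))) ⟩
      h (suc t) + h (p ∸ t) ∎
      where
      t≤p = ℕₚ.≤-trans (ℕₚ.<⇒≤ t<m) (ℕₚ.m≤m*n m 2)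

  brow-convolution : (y : Fin μ) → brow n y ≡ Σℕ μ (convolution (toℕ y)) - + 3 / 2
  brow-convolution y = begin
    M * ½ * vEntry p (toℕ y) - + 3 / 2 * 1ℚ
      + Σℕ (n ℕ./ 2 ∸ 1) (λ t → coeff M (suc t) * rowTimes (cvec n (suc t)) (Dtilde n) y)
      ≡⟨ cong₃ (λ a x S → a * vEntry p x - + 3 / 2 * 1ℚ + S)
               (sym (coeff-0 M)) (sym (subMod-0 (toℕ<n y))) (Σ-coeff-rowTimes y) ⟩
    h 0 - + 3 / 2 * 1ℚ + Σℕ p (h ∘ suc)
      ≡⟨ rearrange (h 0) (Σℕ p (h ∘ suc)) ⟩
    (h 0 + Σℕ p (h ∘ suc)) - + 3 / 2
      ≡⟨ cong (_- + 3 / 2) (Σℕ-front p h) ⟨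
    Σℕ μ h - + 3 / 2 ∎
    where
    open ≡-Reasoning
    h = convolution (toℕ y)
    rearrange : ∀ a s → a - + 3 / 2 * 1ℚ + s ≡ (a + s) - + 3 / 2
    rearrange = solve 2 (λ a s → a :- con (+ 3 / 2) :* con 1ℚ :+ s := (a :+ s) :- con (+ 3 / 2)) refl

  brow-value : 1 ≤ m → (y : Fin μ) → brow n y ≡ (- (+ 2 / 1)) * δ (toℕ y) 0 - ½ * 1ℚ
  brow-value 1≤m y = begin
    brow n y
      ≡⟨ brow-convolution y ⟩
    Σℕ μ (convolution (toℕ y)) - + 3 / 2
      ≡⟨ cong (_- + 3 / 2) (Σ-vEntry p (coeff M) (2≤p 1≤m) (toℕ<n y)) ⟩
    ℚ-of 2 * Σℕ μ (coeff M)
      - (ℚ-of 2 * coeff M (toℕ y) + coeff M (subMod μ (toℕ y) 1) + coeff M (subMod μ (toℕ y) p)) - + 3 / 2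
      ≡⟨ cong₂ (λ S T → ℚ-of 2 * S - T - + 3 / 2) Σ-coeff-odd (coeff-neighbours 1≤m (toℕ<n y)) ⟩
    ℚ-of 2 * ½ - ℚ-of 2 * δ (toℕ y) 0 - + 3 / 2
      ≡⟨ simplify (δ (toℕ y) 0) ⟩
    (- (+ 2 / 1)) * δ (toℕ y) 0 - ½ * 1ℚ ∎
    where
    open ≡-Reasoning
    simplify : ∀ d → ℚ-of 2 * ½ - ℚ-of 2 * d - + 3 / 2 ≡ (- (+ 2 / 1)) * d - ½ * 1ℚ
    simplify = solve 1 (λ d → con (ℚ-of 2) :* con ½ :- con (ℚ-of 2) :* d :- con (+ 3 / 2)
                              := (:- con (+ 2 / 1)) :* d :- con ½ :* con 1ℚ) refl

mainTheorem7 : (n : ℕ) → 8 ≤ n → 2 ∣ n →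
    (i j : Fin (n Data.Nat.∸ 1)) →
      B n i j ≡ (- (+ 2 / 1)) * Id i j - (+ 1 / 2) * Jm i j
mainTheorem7 .(0 ℕ.* 2) ()                    (divides 0 refl)
mainTheorem7 .(1 ℕ.* 2) (s≤s (s≤s ()))        (divides 1 refl)
mainTheorem7 .(suc (suc m) ℕ.* 2) _ (divides (suc (suc m)) refl) i j = begin
  brow n y                                         ≡⟨ brow-value (s≤s z≤n) y ⟩
  (- (+ 2 / 1)) * δ (toℕ y) 0 - ½ * 1ℚ             ≡⟨ cong (λ d → (- (+ 2 / 1)) * d - ½ * 1ℚ) y≡0⇔i≡j ⟩
  (- (+ 2 / 1)) * δ (toℕ i) (toℕ j) - ½ * 1ℚ      ∎
  where
  open ≡-Reasoning
  open OddCycle (suc m)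
  y : Fin μ
  y = (toℕ j ℕ.+ (μ ∸ toℕ i)) mod μ
  y≡0⇔i≡j : δ (toℕ y) 0 ≡ δ (toℕ i) (toℕ j)
  y≡0⇔i≡j = trans (cong (λ x → δ x 0) (toℕ-fromℕ< (m%n<n (toℕ j ℕ.+ (μ ∸ toℕ i)) μ)))
                  (trans (δ-subMod (toℕ<n j) (toℕ<n i) z<s) (cong (δ (toℕ i)) (subMod-0 (toℕ<n j))))
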